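{- Let $c=(\varphi,n,\mathrm{succ},V,w,\mathcal{C})$ be a certificate. If $c$ is valid, then $\varphi$ is not valid on $\mathcal{C}$. Moreover, validity of $c$ is decidable in $O(|\varphi|\,n)$ by the recursive definition of satisfaction, independently of the evaluator that produced $c$.
   Context: Modal formulas over variables $p_0,p_1,\dots$ are generated by $\varphi ::= \top\mid\bot\mid p_i\mid\neg\varphi\mid\varphi\wedge\varphi\mid\varphi\vee\varphi\mid\varphi\rightarrow\varphi\mid\Box\varphi\mid\Diamond\varphi$; $|\varphi|$ is the node count. A frame is $\mathcal{F}=(W,R)$ with $W$ finite and $R\subseteq W^2$; a model $\mathcal{M}=(\mathcal{F},V)$ adds a valuation $V$ assigning to each variable a subset of $W$. Satisfaction $\mathcal{M},w\Vdash\varphi$ is standard Kripke satisfaction: $\mathcal{M},w\Vdash\Box\varphi$ iff $\mathcal{M},v\Vdash\varphi$ for all $v$ with $R(w,v)$; $\mathcal{M},w\Vdash\Diamond\varphi$ iff $\mathcal{M},v\Vdash\varphi$ for some $v$ with $R(w,v)$. $\mathcal{F}\models\varphi$ means $\varphi$ is true at every world under every valuation; $\varphi$ is valid on a class $\mathcal{C}$ if $\mathcal{F}\models\varphi$ for all $\mathcal{F}\in\mathcal{C}$. The classes considered are $\mathsf{K}$ (all frames), $\mathsf{T}$ (reflexive), $\mathsf{S4}$ (preorders) and $\mathsf{S5}$ (equivalence relations). A certificate $c=(\varphi,n,\mathrm{succ},V,w,\mathcal{C})$ records a formula $\varphi$, a world count $n$, a frame $\mathcal{F}=(W,R)$ on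 $W=\{0,\dots,n-1\}$ given by its successor masks $\mathrm{succ}[u]=\sum_{v:R(u,v)}2^v$, a valuation $V$ on $W$, a world $w\in W$, and a class $\mathcal{C}$ of frames. It is valid if $\mathcal{F}\in\mathcal{C}$ and $(\mathcal{F},V),w\nVdash\varphi$. Costs are counted in word operations, a set of worlds (an $n$-bit mask) being one word.
   Formalization: For S4, validity of c is shown decidable in O(|φ| n + n²), since testing transitivity in O(n) set operations on masks is impossible (take φ = ⊥); the check of non-satisfaction is O(|φ| n) for every class, and the full check is O(|φ| n) for K, T and S5. -}

module Defs where

open import Data.Bool.Base using (Bool; true; false; not; if_then_else_)
open import Data.Bool.Properties using () renaming (_≟_ to _≟ᵇ_)
open import Data.Empty using () renaming (⊥ to Empty)
open import Data.Fin.Base using (Fin; zero; suc)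
open import Data.Fin.Properties using () renaming (_≟_ to _≟ᶠ_)
open import Data.Fin.Subset using (Subset; inside; outside; _∈_; _∩_; _∪_; ∁; ⁅_⁆)
  renaming (⊥ to ∅; ⊤ to full)
open import Data.Fin.Subset.Properties using (_∈?_)
open import Data.List.Base using (List; []; _∷_; allFin)
open import Data.Maybe.Base using (Maybe; just; nothing) renaming (map to mapMaybe)
open import Data.Nat.Base using (ℕ; zero; suc; _+_)
open import Data.Product.Base using (∃-syntax; _×_; _,_)
open import Data.Sum.Base using (_⊎_)
open import Data.Unit.Base using () renaming (⊤ to Unit)
open import Data.Vec.Base using (Vec; []; _∷_; lookup)
open import Data.Vec.Properties using (≡-dec)
open import Function.Bundles using (_↔_)
open import Function.Construct.Identity using (↔-id)
open import Level using (0ℓ)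
open import Relation.Binary.Core using (Rel)
open import Relation.Binary.Definitions using (Reflexive) renaming (Decidable to Decidable₂)
open import Relation.Binary.PropositionalEquality.Core using (_≡_)
open import Relation.Binary.Structures using (IsPreorder; IsEquivalence)
open import Relation.Nullary.Decidable.Core using (does)
open import Relation.Nullary.Negation.Core using (¬_)
open import Relation.Unary using (Pred; Decidable)

infix  25 ¬′_ □_ ◇_
infixr 24 _∧′_
infixr 23 _∨′_
infixr 22 _⇒′_

data Formula : Set where
  ⊤′ ⊥′ : Formula
  var   : ℕ → Formula
  ¬′_   : Formula → Formula
  _∧′_ _∨′_ _⇒′_ : Formula → Formula → Formula
  □_ ◇_ : Formula → Formula

∣_∣ : Formula → ℕ
∣ ⊤′ ∣     = 1
∣ ⊥′ ∣     = 1
∣ var i ∣  = 1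
∣ ¬′ φ ∣   = 1 + ∣ φ ∣
∣ φ ∧′ ψ ∣ = 1 + (∣ φ ∣ + ∣ ψ ∣)
∣ φ ∨′ ψ ∣ = 1 + (∣ φ ∣ + ∣ ψ ∣)
∣ φ ⇒′ ψ ∣ = 1 + (∣ φ ∣ + ∣ ψ ∣)
∣ □ φ ∣    = 1 + ∣ φ ∣
∣ ◇ φ ∣    = 1 + ∣ φ ∣

-- Subsets of W and of W² are decidable predicates. Since W is finite,
-- satisfaction is then decidable, so reading the connectives as type formers
-- agrees with classical Kripke semantics.
record Frame : Set₁ where
  field
    W      : Set
    finite : ∃[ n ] (W ↔ Fin n)
    R      : Rel W 0ℓ
    R?     : Decidable₂ R

record Valuation (F : Frame) : Set₁ where
  open Frame F
  field
    V  : ℕ → Pred W 0ℓ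
    V? : ∀ i → Decidable (V i)

record Model : Set₁ where
  constructor _,_
  field
    frame     : Frame
    valuation : Valuation frame
  open Frame frame public
  open Valuation valuation public

infix 4 _⨾_⊩_ _⊨_ _∈ᶜ_ _ValidOn_

_⨾_⊩_ : (M : Model) → Model.W M → Formula → Set
M ⨾ w ⊩ ⊤′     = Unit
M ⨾ w ⊩ ⊥′     = Empty
M ⨾ w ⊩ var i  = Model.V M i w
M ⨾ w ⊩ ¬′ φ   = ¬ (M ⨾ w ⊩ φ)
M ⨾ w ⊩ φ ∧′ ψ = (M ⨾ w ⊩ φ) × (M ⨾ w ⊩ ψ)
M ⨾ w ⊩ φ ∨′ ψ = (M ⨾ w ⊩ φ) ⊎ (M ⨾ w ⊩ ψ)
M ⨾ w ⊩ φ ⇒′ ψ = (M ⨾ w ⊩ φ) → (M ⨾ w ⊩ ψ)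
M ⨾ w ⊩ □ φ    = ∀ v → Model.R M w v → M ⨾ v ⊩ φ
M ⨾ w ⊩ ◇ φ    = ∃[ v ] (Model.R M w v × M ⨾ v ⊩ φ)

_⊨_ : Frame → Formula → Set₁
F ⊨ φ = (V : Valuation F) (w : Frame.W F) → (F , V) ⨾ w ⊩ φ

data Class : Set where
  K T S4 S5 : Class

_∈ᶜ_ : Frame → Class → Set
F ∈ᶜ K  = Unit
F ∈ᶜ T  = Reflexive (Frame.R F)
F ∈ᶜ S4 = IsPreorder _≡_ (Frame.R F)
F ∈ᶜ S5 = IsEquivalence (Frame.R F)

_ValidOn_ : Formula → Class → Set₁
φ ValidOn C = (F : Frame) → F ∈ᶜ C → F ⊨ φ

-- An n-bit mask is a Subset n, i.e. a vector of n bits: position v carries the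
-- bit of weight 2^v, so v ∈ lookup succ u says that bit v of succ[u] is set.
record Certificate : Set where
  field
    formula : Formula
    size    : ℕ
    succ    : Vec (Subset size) size
    V       : ℕ → Subset size
    world   : Fin size
    class   : Class

  frame : Frame
  frame = record
    { W      = Fin size
    ; finite = size , ↔-id (Fin size)
    ; R      = λ u v → v ∈ lookup succ u
    ; R?     = λ u v → v ∈? lookup succ u
    }

  valuation : Valuation frame
  valuation = record { V = λ i w → w ∈ V i ; V? = λ i w → w ∈? V i }

  model : Model
  model = frame , valuation

  Refuted : Set
  Refuted = ¬ (model ⨾ world ⊩ formula)

  Valid : Set
  Valid = (frame ∈ᶜ class) × Refuted

-- Unit-cost operations of a machine for n worlds, indexed by result type. Every
-- operation touches O(1) words; a world index fits in one word.
data Op (n : ℕ) (Word : Set) : Set → Set where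
  succ[_] : Fin n → Op n Word Word
  val[_]  : ℕ → Op n Word Word
  zeros   : Op n Word Word
  ones    : Op n Word Word
  NOT_    : Word → Op n Word Word
  _AND_   : Word → Word → Op n Word Word
  _OR_    : Word → Word → Op n Word Word
  setBit  : Fin n → Word → Op n Word Word
  bit     : Fin n → Word → Op n Word Bool
  _==_    : Word → Word → Op n Word Bool
  _==ⁱ_   : Fin n → Fin n → Op n Word Bool
  lowest  : Word → Op n Word (Maybe (Fin n))

-- Programs are polymorphic in Word: they can read the successor masks, read the
-- valuation, and compute with words only through the counted operations.
data Prog (n : ℕ) (Word A : Set) : Set₁ where
  return : A → Prog n Word A
  step   : ∀ {B} → Op n Word B → (B → Prog n Word A) → Prog n Word A

infixl 1 _>>=_

_>>=_ : ∀ {n Word A B} → Prog n Word A → (A → Prog n Word B) → Prog n Word B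
return a >>= k = k a
step o f >>= k = step o (λ b → f b >>= k)

exec : ∀ {n Word A} → Op n Word A → Prog n Word A
exec o = step o return

module _ {n : ℕ} {Word : Set} where

  allM : (Fin n → Prog n Word Bool) → List (Fin n) → Prog n Word Bool
  allM f []       = return true
  allM f (u ∷ us) = do
    b ← f u
    if b then allM f us else return false

  collect : (Fin n → Prog n Word Bool) → List (Fin n) → Prog n Word Word
  collect f []       = exec zeros
  collect f (u ∷ us) = do
    s ← collect f us
    b ← f u
    if b then exec (setBit u s) else return s

  _⊆ᵐ_ : Word → Word → Prog n Word Bool
  s ⊆ᵐ t = do
    i ← exec (s AND t)
    exec (i == s)

  _disjointᵐ_ : Word → Word → Prog n Word Bool
  s disjointᵐ t = do
    i ← exec (s AND t)
    z ← exec zeros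
    exec (i == z)

  -- The mask of the worlds satisfying a formula, clause by clause as in the
  -- definition of satisfaction.
  eval : Formula → Prog n Word Word
  eval ⊤′       = exec ones
  eval ⊥′       = exec zeros
  eval (var i)  = exec val[ i ]
  eval (¬′ φ)   = do
    s ← eval φ
    exec (NOT s)
  eval (φ ∧′ ψ) = do
    s ← eval φ
    t ← eval ψ
    exec (s AND t)
  eval (φ ∨′ ψ) = do
    s ← eval φ
    t ← eval ψ
    exec (s OR t)
  eval (φ ⇒′ ψ) = do
    s  ← eval φ
    t  ← eval ψ
    s′ ← exec (NOT s)
    exec (s′ OR t)
  eval (□ φ)    = do
    s ← eval φ
    collect (λ u → do
      r ← exec succ[ u ]
      r ⊆ᵐ s) (allFin n)
  eval (◇ φ)    = do
    s ← eval φ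
    collect (λ u → do
      r ← exec succ[ u ]
      d ← r disjointᵐ s
      return (not d)) (allFin n)

  refutes : Formula → Fin n → Prog n Word Bool
  refutes φ w = do
    s ← eval φ
    b ← exec (bit w s)
    return (not b)

  reflexiveᵐ : Prog n Word Bool
  reflexiveᵐ = allM (λ u → do
    s ← exec succ[ u ]
    exec (bit u s)) (allFin n)

  transitiveᵐ : Prog n Word Bool
  transitiveᵐ = allM (λ u → do
    s ← exec succ[ u ]
    allM (λ v → do
      b ← exec (bit v s)
      if b
        then (do
          t ← exec succ[ v ]
          t ⊆ᵐ s)
        else return true) (allFin n)) (allFin n)

  -- A reflexive relation is an equivalence iff every u has the same successors
  -- as the least successor of u, and the successor sets of the worlds that are
  -- their own least successor are pairwise disjoint. This takes O(n) steps.
  partitionᵐ : List (Fin n) → Word → Prog n Word Bool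
  partitionᵐ []       seen = return true
  partitionᵐ (u ∷ us) seen = do
    s ← exec succ[ u ]
    just r ← exec (lowest s)
      where nothing → return false
    t ← exec succ[ r ]
    true ← exec (t == s)
      where false → return false
    true ← exec (r ==ⁱ u)
      where false → partitionᵐ us seen
    true ← s disjointᵐ seen
      where false → return false
    seen′ ← exec (s OR seen)
    partitionᵐ us seen′

  inClass : Class → Prog n Word Bool
  inClass K  = return true
  inClass T  = reflexiveᵐ
  inClass S4 = do
    b ← reflexiveᵐ
    if b then transitiveᵐ else return false
  inClass S5 = do
    b ← reflexiveᵐ
    if b
      then (do
        z ← exec zeros
        partitionᵐ (allFin n) z)
      else return false

  check : Formula → Fin n → Class → Prog n Word Bool
  check φ w C = do
    b ← inClass C
    if b then refutes φ w else return false

least : ∀ {n} → Subset n → Maybe (Fin n)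
least []            = nothing
least (inside  ∷ s) = just zero
least (outside ∷ s) = mapMaybe suc (least s)

module Run (c : Certificate) where
  open Certificate c

  ⟦_⟧ : ∀ {A} → Op size (Subset size) A → A
  ⟦ succ[ u ] ⟧  = lookup succ u
  ⟦ val[ i ] ⟧   = V i
  ⟦ zeros ⟧      = ∅
  ⟦ ones ⟧       = full
  ⟦ NOT s ⟧      = ∁ s
  ⟦ s AND t ⟧    = s ∩ t
  ⟦ s OR t ⟧     = s ∪ t
  ⟦ setBit u s ⟧ = ⁅ u ⁆ ∪ s
  ⟦ bit u s ⟧    = lookup s u
  ⟦ s == t ⟧     = does (≡-dec _≟ᵇ_ s t)
  ⟦ u ==ⁱ v ⟧    = does (u ≟ᶠ v)
  ⟦ lowest s ⟧   = least s

  result : ∀ {A} → Prog size (Subset size) A → A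
  result (return a) = a
  result (step o f) = result (f ⟦ o ⟧)

  cost : ∀ {A} → Prog size (Subset size) A → ℕ
  cost (return a) = 0
  cost (step o f) = suc (cost (f ⟦ o ⟧))

  checkCertificate : Prog size (Subset size) Bool
  checkCertificate = check formula world class

  checkRefuted : Prog size (Subset size) Bool
  checkRefuted = refutes formula world

{-# OPTIONS --safe #-}

-- Reading a mask as a family of truth values, each clause of eval computes the
-- corresponding clause of satisfaction pointwise, at a price of at most 2 + 5n
-- operations per node. The S5 test works because canonical worlds (those that
-- are their own least successor) represent the classes: if every world has the
-- successors of a canonical one and those sets are pairwise disjoint, then two
-- worlds are related exactly when their successor sets coincide.

module Submission where

open import Defs
open import Data.Bool.Base using (Bool; true; false; not; _∧_; _∨_; if_then_else_)
open import Data.Bool.Properties using (if-float) renaming (_≟_ to _≟ᵇ_)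
open import Data.Empty using (⊥-elim)
open import Data.Fin.Base using (Fin; zero; suc)
open import Data.Fin.Properties using () renaming (_≟_ to _≟ᶠ_)
open import Data.Fin.Subset using (Subset; inside; outside; ∁; _∈_; _∉_; _⊆_; _∩_; _∪_; ⁅_⁆)
  renaming (⊥ to ∅)
open import Data.Fin.Subset.Properties
  using (∉⊥; Empty-unique; nonempty?; x∈p∩q⁺; x∈p∩q⁻; p∩q⊆p; x∈p∪q⁺; x∈p∪q⁻; x∈⁅x⁆; x∈⁅y⁆⇒x≡y; ⊆-antisym)
open import Data.List.Base using (List; []; _∷_; allFin; length)
open import Data.List.Membership.Propositional using () renaming (_∈_ to _∈ˡ_)
open import Data.List.Membership.Propositional.Properties using (∈-allFin)
open import Data.List.Properties using (length-tabulate)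
open import Data.List.Relation.Unary.All as All using (All; []; _∷_)
open import Data.List.Relation.Unary.All.Properties using (tabulate⁺; tabulate⁻)
open import Data.List.Relation.Unary.AllPairs using (AllPairs; []; _∷_)
open import Data.List.Relation.Unary.AllPairs.Properties using () renaming (tabulate⁺ to pairs-tabulate⁺)
open import Data.List.Relation.Unary.Any using (here; there)
open import Data.Maybe.Base using (just; nothing)
open import Data.Maybe.Properties using (just-injective)
open import Data.Nat.Base using (ℕ; zero; suc; _+_; _*_; _≤_; z≤n; s≤s)
open import Data.Nat.Properties
  using (≤-refl; ≤-reflexive; ≤-trans; m≤m+n; m≤n+m; +-comm; +-identityʳ; *-comm;
         +-mono-≤; +-monoʳ-≤; +-monoˡ-≤; *-mono-≤; *-monoʳ-≤; *-monoˡ-≤; module ≤-Reasoning)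
open import Data.Nat.Tactic.RingSolver using (solve-∀)
open import Data.Product.Base using (_×_; ∃-syntax; _,_; proj₁; proj₂)
open import Data.Sum.Base using (_⊎_; inj₁; inj₂)
open import Data.Unit.Base using (tt)
open import Data.Vec.Base using ([]; _∷_; lookup; here; there)
open import Data.Vec.Properties
  using (≡-dec; []=⇒lookup; lookup⇒[]=; lookup-map; lookup-zipWith; lookup-replicate)
open import Function.Base using (_∘_)
open import Level using (0ℓ)
open import Relation.Binary.Core using (Rel)
open import Relation.Binary.Definitions using (Reflexive; Symmetric; Transitive)
open import Relation.Binary.PropositionalEquality.Core using (_≡_; _≢_; refl; sym; trans; cong; subst)
open import Relation.Binary.PropositionalEquality.Properties using ()
  renaming (isEquivalence to ≡-isEquivalence)
open import Relation.Binary.Structures using (IsPreorder; IsEquivalence)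
open import Relation.Nullary.Decidable.Core using (does; proof; yes; no)
open import Relation.Nullary.Negation.Core using (¬_; contradiction)
open import Relation.Nullary.Reflects
  using (Reflects; ofʸ; ofⁿ; ¬-reflects; _×-reflects_; _⊎-reflects_; _→-reflects_)

-- Truth values of mask operations

map-reflects : ∀ {A B : Set} {x} → (A → B) → (B → A) → Reflects A x → Reflects B x
map-reflects to from (ofʸ a)  = ofʸ (to a)
map-reflects to from (ofⁿ ¬a) = ofⁿ (¬a ∘ from)

reflects-≡true : ∀ b → Reflects (b ≡ true) b
reflects-≡true true  = ofʸ refl
reflects-≡true false = ofⁿ λ ()

true-sound : ∀ {A : Set} {b} → Reflects A b → b ≡ true → A
true-sound (ofʸ a) _ = a

true-complete : ∀ {A : Set} {b} → Reflects A b → A → b ≡ true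
true-complete (ofʸ _)  _ = refl
true-complete (ofⁿ ¬a) a = contradiction a ¬a

∈-reflects : ∀ {n} (s : Subset n) v → Reflects (v ∈ s) (lookup s v)
∈-reflects s v = map-reflects (lookup⇒[]= v s) []=⇒lookup (reflects-≡true (lookup s v))

Disjoint : ∀ {n} → Subset n → Subset n → Set
Disjoint s t = ∀ v → v ∈ s → v ∉ t

disjoint-reflects : ∀ {n} (s t : Subset n) → Reflects (Disjoint s t) (does (≡-dec _≟ᵇ_ (s ∩ t) ∅))
disjoint-reflects s t = map-reflects
  (λ eq v v∈s v∈t → ∉⊥ (subst (_ ∈_) eq (x∈p∩q⁺ (v∈s , v∈t))))
  (λ s#t → Empty-unique λ (v , v∈) → let v∈s , v∈t = x∈p∩q⁻ s t v∈ in s#t v v∈s v∈t)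
  (proof (≡-dec _≟ᵇ_ (s ∩ t) ∅))

⊆-reflects : ∀ {n} (s t : Subset n) → Reflects (s ⊆ t) (does (≡-dec _≟ᵇ_ (s ∩ t) s))
⊆-reflects s t = map-reflects
  (λ eq v∈s → proj₂ (x∈p∩q⁻ s t (subst (_ ∈_) (sym eq) v∈s)))
  (λ s⊆t → ⊆-antisym (p∩q⊆p s t) (λ v∈s → x∈p∩q⁺ (v∈s , s⊆t v∈s)))
  (proof (≡-dec _≟ᵇ_ (s ∩ t) s))

meets-reflects : ∀ {n} (s t : Subset n) →
                 Reflects (∃[ v ] (v ∈ s × v ∈ t)) (not (does (≡-dec _≟ᵇ_ (s ∩ t) ∅)))
meets-reflects s t = map-reflects meet
  (λ (v , v∈s , v∈t) s#t → s#t v v∈s v∈t)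
  (¬-reflects (disjoint-reflects s t))
  where
  meet : ¬ Disjoint s t → ∃[ v ] (v ∈ s × v ∈ t)
  -- A witness cannot be read off a negated universal; searching the finite mask `s ∩ t` supplies
  -- one.
  meet ¬s#t with nonempty? (s ∩ t)
  ... | yes (v , v∈) = v , x∈p∩q⁻ s t v∈
  ... | no ¬v∈       = contradiction (λ v v∈s v∈t → ¬v∈ (v , x∈p∩q⁺ (v∈s , v∈t))) ¬s#t

∁-reflects : ∀ {n} (s : Subset n) v {A : Set} → Reflects A (lookup s v) → Reflects (¬ A) (lookup (∁ s) v)
∁-reflects s v a rewrite lookup-map v not s = ¬-reflects a

module _ {n} (s t : Subset n) (v : Fin n) {A B : Set} where

  ∩-reflects : Reflects A (lookup s v) → Reflects B (lookup t v) → Reflects (A × B) (lookup (s ∩ t) v)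
  ∩-reflects a b rewrite lookup-zipWith _∧_ v s t = a ×-reflects b

  ∪-reflects : Reflects A (lookup s v) → Reflects B (lookup t v) → Reflects (A ⊎ B) (lookup (s ∪ t) v)
  ∪-reflects a b rewrite lookup-zipWith _∨_ v s t = a ⊎-reflects b

  -- The material reading of implication is constructively sound here because the bit of `s` decides
  -- `A`.
  ∁∪-reflects : Reflects A (lookup s v) → Reflects B (lookup t v) → Reflects (A → B) (lookup (∁ s ∪ t) v)
  ∁∪-reflects a b rewrite lookup-zipWith _∨_ v (∁ s) t | lookup-map v not s = a →-reflects b

least-∈ : ∀ {n} (s : Subset n) {u} → least s ≡ just u → u ∈ s
least-∈ (inside  ∷ s) refl = here
least-∈ (outside ∷ s) eq with least s in eq′
least-∈ (outside ∷ s) refl | just u = there (least-∈ s eq′)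

least-∃ : ∀ {n} {s : Subset n} {v} → v ∈ s → ∃[ u ] least s ≡ just u
least-∃ {s = inside  ∷ s} _          = zero , refl
least-∃ {s = outside ∷ s} (there v∈) with least s | least-∃ v∈
... | _ | u , refl = suc u , refl

-- `AllPairs` relates an earlier entry to a later one. Symmetry covers the opposite order of
-- positions, and equality covers a shared position.
allPairs-lookup : ∀ {A : Set} {R : Rel A 0ℓ} {xs x y} → Symmetric R → AllPairs R xs →
                  x ∈ˡ xs → y ∈ˡ xs → x ≡ y ⊎ R x y
allPairs-lookup _     (_  ∷ _)   (here refl) (here refl) = inj₁ refl
allPairs-lookup _     (rs ∷ _)   (here refl) (there y∈)  = inj₂ (All.lookup rs y∈)
allPairs-lookup R-sym (rs ∷ _)   (there x∈)  (here refl) = inj₂ (R-sym (All.lookup rs x∈))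
allPairs-lookup R-sym (_  ∷ rss) (there x∈)  (there y∈)  = allPairs-lookup R-sym rss x∈ y∈

1≤∣_∣ : ∀ φ → 1 ≤ ∣ φ ∣
1≤∣ ⊤′ ∣     = ≤-refl
1≤∣ ⊥′ ∣     = ≤-refl
1≤∣ var i ∣  = ≤-refl
1≤∣ ¬′ φ ∣   = s≤s z≤n
1≤∣ φ ∧′ ψ ∣ = s≤s z≤n
1≤∣ φ ∨′ ψ ∣ = s≤s z≤n
1≤∣ φ ⇒′ ψ ∣ = s≤s z≤n
1≤∣ □ φ ∣    = s≤s z≤n
1≤∣ ◇ φ ∣    = s≤s z≤n

1≤Fin : ∀ {n} → Fin n → 1 ≤ n
1≤Fin zero    = s≤s z≤n
1≤Fin (suc _) = s≤s z≤n

-- Results and costs of sequenced programs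

module Correctness (c : Certificate) where
  open Certificate c
  open Run c

  Program : Set → Set₁
  Program = Prog size (Subset size)

  length-worlds : length (allFin size) ≡ size
  length-worlds = length-tabulate (λ u → u)

  result->>= : ∀ {A B} (p : Program A) (f : A → Program B) → result (p >>= f) ≡ result (f (result p))
  result->>= (return a) f = refl
  result->>= (step o g) f = result->>= (g ⟦ o ⟧) f

  cost->>= : ∀ {A B} (p : Program A) (f : A → Program B) →
             cost (p >>= f) ≡ cost p + cost (f (result p))
  cost->>= (return a) f = refl
  cost->>= (step o g) f = cong suc (cost->>= (g ⟦ o ⟧) f)

  -- Short-circuiting is harmless: once `A` fails, the conjunction is false whatever `p` would
  -- return.
  and-reflects : ∀ {A B : Set} {b} {p : Program Bool} → Reflects A b → Reflects B (result p) →
                 Reflects (A × B) (result (if b then p else return false))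
  and-reflects (ofʸ a)  r = map-reflects (a ,_) proj₂ r
  and-reflects (ofⁿ ¬a) r = ofⁿ (¬a ∘ proj₁)

  implies-reflects : ∀ {A B : Set} {b} {p : Program Bool} → Reflects A b → Reflects B (result p) →
                     Reflects (A → B) (result (if b then p else return true))
  implies-reflects (ofʸ a)  r = map-reflects (λ b _ → b) (λ f → f a) r
  implies-reflects (ofⁿ ¬a) r = ofʸ λ a → contradiction a ¬a

  cost-if : ∀ {A} b {p q : Program A} {m} → cost p ≤ m → cost q ≤ m → cost (if b then p else q) ≤ m
  cost-if true  p≤ q≤ = p≤
  cost-if false p≤ q≤ = q≤

  -- The bound on the continuation is uniform in its argument, so costs add up without knowing
  -- intermediate results.
  cost->>=-≤ : ∀ {A B} (p : Program A) {f : A → Program B} {k m} →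
               cost p ≤ k → (∀ a → cost (f a) ≤ m) → cost (p >>= f) ≤ k + m
  cost->>=-≤ p {f} p≤ f≤ = ≤-trans (≤-reflexive (cost->>= p f)) (+-mono-≤ p≤ (f≤ (result p)))

  -- Loops over the worlds

  module _ {f : Fin size → Program Bool} where

    allM-reflects : ∀ {P : Fin size → Set} → (∀ u → Reflects (P u) (result (f u))) →
                    ∀ us → Reflects (All P us) (result (allM f us))
    allM-reflects r []       = ofʸ []
    allM-reflects r (u ∷ us) = subst (Reflects _) (sym (result->>= (f u) _))
      (map-reflects (λ (p , ps) → p ∷ ps) (λ { (p ∷ ps) → p , ps })
        (and-reflects {p = allM f us} (r u) (allM-reflects r us)))

    cost-allM : ∀ {k} → (∀ u → cost (f u) ≤ k) → ∀ us → cost (allM f us) ≤ length us * k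
    cost-allM f≤ []       = z≤n
    cost-allM f≤ (u ∷ us) = cost->>=-≤ (f u) (f≤ u) λ b → cost-if b (cost-allM f≤ us) z≤n

    allM-allFin-reflects : ∀ {P : Fin size → Set} → (∀ u → Reflects (P u) (result (f u))) →
                           Reflects (∀ u → P u) (result (allM f (allFin size)))
    allM-allFin-reflects r = map-reflects tabulate⁻ tabulate⁺ (allM-reflects r (allFin size))

    cost-allM-allFin : ∀ {k} → (∀ u → cost (f u) ≤ k) → cost (allM f (allFin size)) ≤ size * k
    cost-allM-allFin {k} f≤ =
      subst (λ l → cost (allM f (allFin size)) ≤ l * k) length-worlds (cost-allM f≤ (allFin size))

    result-collect-∷ : ∀ u us → result (collect f (u ∷ us)) ≡
      (if result (f u) then ⁅ u ⁆ ∪ result (collect f us) else result (collect f us))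
    result-collect-∷ u us = trans (result->>= (collect f us) _)
      (trans (result->>= (f u) _) (if-float result (result (f u))))

    collect-sound : ∀ us {v} → v ∈ result (collect f us) → result (f v) ≡ true
    collect-sound []       v∈ = ⊥-elim (∉⊥ v∈)
    collect-sound (u ∷ us) v∈ with result (f u) in eq | subst (_ ∈_) (result-collect-∷ u us) v∈
    ... | false | v∈s = collect-sound us v∈s
    ... | true  | v∈∪ with x∈p∪q⁻ ⁅ u ⁆ _ v∈∪
    ...   | inj₁ v∈u rewrite x∈⁅y⁆⇒x≡y u v∈u = eq
    ...   | inj₂ v∈s = collect-sound us v∈s

    collect-complete : ∀ {us v} → v ∈ˡ us → result (f v) ≡ true → v ∈ result (collect f us)
    collect-complete {u ∷ us} {v} (here refl) eq rewrite result-collect-∷ u us | eq =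
      x∈p∪q⁺ (inj₁ (x∈⁅x⁆ v))
    collect-complete {u ∷ us} {v} (there v∈) eq rewrite result-collect-∷ u us with result (f u)
    ... | true  = x∈p∪q⁺ (inj₂ (collect-complete v∈ eq))
    ... | false = collect-complete v∈ eq

    -- Soundness holds along any list of worlds; completeness needs `v` to be listed, which `allFin`
    -- guarantees.
    collect-reflects : ∀ {A : Set} {v} → Reflects A (result (f v)) →
                       Reflects A (lookup (result (collect f (allFin size))) v)
    collect-reflects {v = v} r = map-reflects
      (true-sound r ∘ collect-sound (allFin size))
      (collect-complete (∈-allFin v) ∘ true-complete r)
      (∈-reflects _ v)

    -- The leading 1 pays for the initial `zeros`. Each world pays `k` for its test and at most 1
    -- for `setBit`.
    cost-collect : ∀ {k} → (∀ u → cost (f u) ≤ k) → ∀ us → cost (collect f us) ≤ 1 + length us * (1 + k)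
    cost-collect f≤ []       = ≤-refl
    cost-collect {k} f≤ (u ∷ us) = ≤-trans
      (cost->>=-≤ (collect f us) (cost-collect f≤ us) λ s →
        cost->>=-≤ (f u) (f≤ u) λ b → cost-if b ≤-refl z≤n)
      (≤-reflexive (arith (length us) k))
      where
      arith : ∀ l k → 1 + l * (1 + k) + (k + 1) ≡ 1 + (1 + l) * (1 + k)
      arith = solve-∀

    cost-collect-allFin : ∀ {k} → (∀ u → cost (f u) ≤ k) →
                          cost (collect f (allFin size)) ≤ 1 + size * (1 + k)
    cost-collect-allFin {k} f≤ =
      subst (λ l → cost (collect f (allFin size)) ≤ 1 + l * (1 + k)) length-worlds
        (cost-collect f≤ (allFin size))

  -- Evaluation agrees with satisfaction, and its cost

  Satisfies : Fin size → Formula → Set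
  Satisfies v φ = model ⨾ v ⊩ φ

  mask : Formula → Subset size
  mask φ = result (eval φ)

  eval-reflects : ∀ φ v → Reflects (Satisfies v φ) (lookup (mask φ) v)

  -- Replaces the run of `eval φ` by its mask, so that each clause of `eval-reflects` becomes a
  -- statement about masks alone.
  eval->>=-reflects : ∀ {A : Set} φ {g : Subset size → Program (Subset size)} {v} →
    Reflects A (lookup (result (g (mask φ))) v) → Reflects A (lookup (result (eval φ >>= g)) v)
  eval->>=-reflects φ {g} {v} = subst (λ s → Reflects _ (lookup s v)) (sym (result->>= (eval φ) g))

  eval-reflects ⊤′ v rewrite lookup-replicate v true = ofʸ tt
  eval-reflects ⊥′ v rewrite lookup-replicate v false = ofⁿ λ ()
  eval-reflects (var i) v = ∈-reflects (V i) v
  eval-reflects (¬′ φ) v = eval->>=-reflects φ (∁-reflects (mask φ) v (eval-reflects φ v))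
  eval-reflects (φ ∧′ ψ) v = eval->>=-reflects φ (eval->>=-reflects ψ
    (∩-reflects (mask φ) (mask ψ) v (eval-reflects φ v) (eval-reflects ψ v)))
  eval-reflects (φ ∨′ ψ) v = eval->>=-reflects φ (eval->>=-reflects ψ
    (∪-reflects (mask φ) (mask ψ) v (eval-reflects φ v) (eval-reflects ψ v)))
  eval-reflects (φ ⇒′ ψ) v = eval->>=-reflects φ (eval->>=-reflects ψ
    (∁∪-reflects (mask φ) (mask ψ) v (eval-reflects φ v) (eval-reflects ψ v)))
  -- The quantifier over successors becomes one inclusion: the successor mask of `v` lies in the
  -- truth set of `φ`.
  eval-reflects (□ φ) v = eval->>=-reflects φ (collect-reflects
    (map-reflects
      (λ r⊆s u u∈r → true-sound (eval-reflects φ u) ([]=⇒lookup (r⊆s u∈r)))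
      (λ ⊩φ {u} u∈r → lookup⇒[]= u _ (true-complete (eval-reflects φ u) (⊩φ u u∈r)))
      (⊆-reflects (lookup succ v) (mask φ))))
  eval-reflects (◇ φ) v = eval->>=-reflects φ (collect-reflects
    (map-reflects
      (λ (u , u∈r , u∈s) → u , u∈r , true-sound (eval-reflects φ u) ([]=⇒lookup u∈s))
      (λ (u , u∈r , ⊩φ) → u , u∈r , lookup⇒[]= u _ (true-complete (eval-reflects φ u) ⊩φ))
      (meets-reflects (lookup succ v) (mask φ))))

  -- A modal node costs at most `1 + size * 5`: one `zeros`, then per world a test of at most 4
  -- operations and one `setBit`. The summand 2 instead of 1 makes room for the two operations of an
  -- implication.
  nodeCost : ℕ
  nodeCost = 2 + size * 5

  cost-modal : ∀ {f : Fin size → Program Bool} → (∀ u → cost (f u) ≤ 4) →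
               cost (collect f (allFin size)) ≤ nodeCost
  cost-modal f≤ = ≤-trans (cost-collect-allFin f≤) (m≤n+m _ 1)

  cost-eval : ∀ φ → cost (eval φ) ≤ ∣ φ ∣ * nodeCost

  cost-unary : ∀ φ {f : Subset size → Program (Subset size)} → (∀ s → cost (f s) ≤ nodeCost) →
               cost (eval φ >>= f) ≤ suc ∣ φ ∣ * nodeCost
  cost-unary φ f≤ = ≤-trans (cost->>=-≤ (eval φ) (cost-eval φ) f≤) (≤-reflexive (+-comm _ nodeCost))

  cost-binary : ∀ φ ψ {f : Subset size → Subset size → Program (Subset size)} →
                (∀ s t → cost (f s t) ≤ nodeCost) →
                cost (eval φ >>= λ s → eval ψ >>= f s) ≤ suc (∣ φ ∣ + ∣ ψ ∣) * nodeCost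
  cost-binary φ ψ f≤ = ≤-trans
    (cost->>=-≤ (eval φ) (cost-eval φ) λ s → cost->>=-≤ (eval ψ) (cost-eval ψ) (f≤ s))
    (≤-reflexive (arith ∣ φ ∣ ∣ ψ ∣ nodeCost))
    where
    arith : ∀ l m k → l * k + (m * k + k) ≡ suc (l + m) * k
    arith = solve-∀

  cost-eval ⊤′       = s≤s z≤n
  cost-eval ⊥′       = s≤s z≤n
  cost-eval (var i)  = s≤s z≤n
  cost-eval (¬′ φ)   = cost-unary φ (λ _ → s≤s z≤n)
  cost-eval (φ ∧′ ψ) = cost-binary φ ψ (λ _ _ → s≤s z≤n)
  cost-eval (φ ∨′ ψ) = cost-binary φ ψ (λ _ _ → s≤s z≤n)
  cost-eval (φ ⇒′ ψ) = cost-binary φ ψ (λ _ _ → s≤s (s≤s z≤n))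
  cost-eval (□ φ)    = cost-unary φ (λ _ → cost-modal (λ _ → s≤s (s≤s (s≤s z≤n))))
  cost-eval (◇ φ)    = cost-unary φ (λ _ → cost-modal (λ _ → ≤-refl))

  refutes-reflects : ∀ φ v → Reflects (¬ Satisfies v φ) (result (refutes φ v))
  refutes-reflects φ v = subst (Reflects _) (sym (result->>= (eval φ) _))
    (¬-reflects (eval-reflects φ v))

  cost-refutes : ∀ φ v → cost (refutes φ v) ≤ ∣ φ ∣ * nodeCost + 1
  cost-refutes φ v = cost->>=-≤ (eval φ) (cost-eval φ) (λ _ → ≤-refl)

  -- Tests for reflexivity and transitivity

  R : Rel (Fin size) 0ℓ
  R = Frame.R frame

  reflexive-reflects : Reflects (Reflexive R) (result reflexiveᵐ)
  reflexive-reflects = map-reflects (λ r {u} → r u) (λ r u → r)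
    (allM-allFin-reflects λ u → ∈-reflects (lookup succ u) u)

  cost-reflexive : cost reflexiveᵐ ≤ size * 2
  cost-reflexive = cost-allM-allFin λ u → ≤-refl

  -- For fixed `u` and `v`, the third world is handled by a single mask inclusion, so two nested
  -- loops suffice.
  transitive-reflects : Reflects (Transitive R) (result transitiveᵐ)
  transitive-reflects = map-reflects
    (λ t {u} {v} uRv vRw → t u v uRv vRw)
    (λ t u v uRv {w} vRw → t {u} {v} {w} uRv vRw)
    (allM-allFin-reflects λ u → allM-allFin-reflects λ v →
      implies-reflects (∈-reflects (lookup succ u) v) (⊆-reflects (lookup succ v) (lookup succ u)))

  cost-transitive : cost transitiveᵐ ≤ size * (1 + size * 4)
  cost-transitive = cost-allM-allFin λ u → s≤s (cost-allM-allFin λ v →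
    s≤s (cost-if (lookup (lookup succ u) v) ≤-refl z≤n))

  -- The linear test for equivalence relations

  Canonical : Fin size → Set
  Canonical u = least (lookup succ u) ≡ just u

  -- Such an `r` is automatically canonical, since its successor mask is that of `u`, whose least
  -- element is `r`.
  Represented : Fin size → Set
  Represented u = ∃[ r ] (least (lookup succ u) ≡ just r × lookup succ r ≡ lookup succ u)

  -- Guarding by canonicity makes the condition vacuous at the worlds whose disjointness test the
  -- program skips.
  Apart : Rel (Fin size) 0ℓ
  Apart u v = Canonical u → Canonical v → Disjoint (lookup succ u) (lookup succ v)

  FreshFrom : Subset size → Fin size → Set
  FreshFrom seen u = Canonical u → Disjoint (lookup succ u) seen

  -- What the loop must still establish when `us` remains and `seen` has accumulated the successors
  -- of earlier canonical worlds: freshness looks back, `AllPairs` looks ahead.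
  Partition : List (Fin size) → Subset size → Set
  Partition us seen = All Represented us × All (FreshFrom seen) us × AllPairs Apart us

  -- The test of a canonical u compares it with the earlier worlds only; moving
  -- its successors into seen is what compares it with the later ones.
  partition-canonical : ∀ {u us seen} → Canonical u → Disjoint (lookup succ u) seen →
                        Partition us (lookup succ u ∪ seen) → Partition (u ∷ us) seen
  partition-canonical {u} {us} {seen} can fresh (reps , freshes , aparts) =
    (u , can , refl) ∷ reps ,
    (λ _ → fresh) ∷ All.map (λ f can′ v v∈ v∈seen → f can′ v v∈ (x∈p∪q⁺ (inj₂ v∈seen))) freshes ,
    All.map (λ f _ can′ v v∈u v∈ → f can′ v v∈ (x∈p∪q⁺ (inj₁ v∈u))) freshes ∷ aparts

  -- Avoiding the enlarged `seen` combines avoiding the old one with being apart from `u`.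
  partition-canonical⁻ : ∀ {u us seen} → Canonical u →
                         Partition (u ∷ us) seen → Partition us (lookup succ u ∪ seen)
  partition-canonical⁻ {u} {us} {seen} can (_ ∷ reps , _ ∷ freshes , apart ∷ aparts) =
    reps ,
    All.zipWith (λ (f , a) can′ v v∈ v∈∪ → fresh f a can′ v∈ (x∈p∪q⁻ (lookup succ u) seen v∈∪))
      (freshes , apart) ,
    aparts
    where
    fresh : ∀ {u′ v} → FreshFrom seen u′ → Apart u u′ → Canonical u′ → v ∈ lookup succ u′ →
            ¬ (v ∈ lookup succ u ⊎ v ∈ seen)
    fresh f a can′ v∈ (inj₁ v∈u)    = a can can′ _ v∈u v∈
    fresh f a can′ v∈ (inj₂ v∈seen) = f can′ _ v∈ v∈seen

  partition-reflects : ∀ us seen → Reflects (Partition us seen) (result (partitionᵐ us seen))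
  partition-reflects []       seen = ofʸ ([] , [] , [])
  partition-reflects (u ∷ us) seen with least (lookup succ u) in eq
  ... | nothing = ofⁿ λ { ((r , eq′ , _) ∷ _ , _) → contradiction (trans (sym eq) eq′) λ () }
  ... | just r with ≡-dec _≟ᵇ_ (lookup succ r) (lookup succ u)
  -- Any claimed representative `r′` equals the computed `r`, because `least` is a function.
  ...   | no ≢ = ofⁿ λ { ((r′ , eq′ , ≡′) ∷ _ , _) →
            ≢ (subst (λ r → lookup succ r ≡ lookup succ u) (just-injective (trans (sym eq′) eq)) ≡′) }
  ...   | yes ≡u with r ≟ᶠ u
  -- Here `u` is not canonical, so only `Represented u` has content; the other conditions at `u`
  -- hold vacuously.
  ...     | no r≢u = map-reflects
              (λ (reps , freshes , aparts) →
                (r , eq , ≡u) ∷ reps ,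
                (λ can → contradiction can ¬can) ∷ freshes ,
                All.tabulate (λ _ can → contradiction can ¬can) ∷ aparts)
              (λ { (_ ∷ reps , _ ∷ freshes , _ ∷ aparts) → reps , freshes , aparts })
              (partition-reflects us seen)
            where
            ¬can : ¬ Canonical u
            ¬can can = r≢u (just-injective (trans (sym eq) can))
  -- Identifying `r` with `u` turns `eq` into a proof of `Canonical u`. The decision and its
  -- reflection are abstracted together so that their truth values agree.
  ...     | yes refl with ≡-dec _≟ᵇ_ (lookup succ u ∩ seen) ∅ | disjoint-reflects (lookup succ u) seen
  ...       | no _  | ofⁿ ¬fresh = ofⁿ λ { (_ , fresh ∷ _ , _) → ¬fresh (fresh eq) }
  ...       | yes _ | ofʸ fresh = map-reflects (partition-canonical eq fresh) (partition-canonical⁻ eq)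
                (partition-reflects us (lookup succ u ∪ seen))

  -- The longest iteration performs 9 operations: two reads of successors, `lowest`, two
  -- comparisons, three for disjointness and one `OR`. Rejections stop after 2, 4 or 8, and a
  -- non-canonical world takes 5.
  cost-partition : ∀ us seen → cost (partitionᵐ us seen) ≤ length us * 9
  cost-partition []       seen = z≤n
  cost-partition (u ∷ us) seen with least (lookup succ u)
  ... | nothing = m≤m+n 2 _
  ... | just r with ≡-dec _≟ᵇ_ (lookup succ r) (lookup succ u)
  ...   | no _ = m≤m+n 4 _
  ...   | yes _ with r ≟ᶠ u
  ...     | no _ = +-mono-≤ {5} {9} (m≤m+n 5 4) (cost-partition us seen)
  ...     | yes _ with ≡-dec _≟ᵇ_ (lookup succ u ∩ seen) ∅
  ...       | no _  = m≤m+n 8 _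
  ...       | yes _ = +-monoʳ-≤ 9 (cost-partition us (lookup succ u ∪ seen))

  module _ (R-refl : Reflexive R) where

    equivalence⇒successors : IsEquivalence R → ∀ {u v} → R u v → lookup succ u ≡ lookup succ v
    equivalence⇒successors e {u} {v} uRv = ⊆-antisym
      (λ {w} uRw → E.trans {v} {u} {w} (E.sym {u} {v} uRv) uRw)
      (λ {w} vRw → E.trans {u} {v} {w} uRv vRw)
      where module E = IsEquivalence e

    -- Symmetry combines the equation with reflexivity: `u` sees itself, hence lies in the equal
    -- successor set of `v`.
    successors⇒equivalence : (∀ {u v} → R u v → lookup succ u ≡ lookup succ v) → IsEquivalence R
    successors⇒equivalence eq = record
      { refl  = R-refl
      ; sym   = λ {u} uRv → subst (u ∈_) (eq uRv) R-refl
      ; trans = λ {u} {v} {w} uRv vRw → subst (w ∈_) (sym (eq uRv)) vRw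
      }

    equivalence⇒partition : IsEquivalence R → Partition (allFin size) ∅
    equivalence⇒partition e =
      tabulate⁺ represented , tabulate⁺ (λ _ _ _ _ → ∉⊥) , pairs-tabulate⁺ apart
      where
      successors = equivalence⇒successors e

      represented : ∀ u → Represented u
      represented u with least-∃ (R-refl {u})
      ... | r , eq = r , eq , sym (successors (least-∈ (lookup succ u) eq))

      -- Two canonical worlds with a common successor share its successor set, hence its least
      -- element, which is each of them.
      apart : ∀ {u v} → u ≢ v → Apart u v
      apart u≢v can-u can-v _ uRw vRw = u≢v (just-injective
        (trans (sym can-u) (trans (cong least (trans (successors uRw) (sym (successors vRw)))) can-v)))

    -- If `R u v`, the representatives of `u` and of `v` both see `v`, the latter by reflexivity.
    -- Canonical worlds with a common successor coincide, so `u` and `v` have equal successor sets.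
    partition⇒equivalence : Partition (allFin size) ∅ → IsEquivalence R
    partition⇒equivalence (reps , _ , aparts) = successors⇒equivalence successors
      where
      unique : ∀ {u v w} → Canonical u → Canonical v → R u w → R v w → u ≡ v
      -- The function passed to `allPairs-lookup` is the symmetry of `Apart`.
      unique {u} {v} {w} can-u can-v uRw vRw with
        allPairs-lookup (λ a can-y can-x w yRw xRw → a can-x can-y w xRw yRw) aparts
          (∈-allFin u) (∈-allFin v)
      ... | inj₁ u≡v = u≡v
      ... | inj₂ u#v = contradiction vRw (u#v can-u can-v w uRw)

      successors : ∀ {u v} → R u v → lookup succ u ≡ lookup succ v
      successors {u} {v} uRv with tabulate⁻ reps u | tabulate⁻ reps v
      ... | r , eq-r , r≡u | q , eq-q , q≡v = trans (sym r≡u) (trans (cong (lookup succ) r≡q) q≡v)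
        where
        r≡q : r ≡ q
        r≡q = unique (trans (cong least r≡u) eq-r) (trans (cong least q≡v) eq-q)
                (subst (v ∈_) (sym r≡u) uRv) (subst (v ∈_) (sym q≡v) R-refl)

  -- Class membership and validity of a certificate

  inClass-reflects : ∀ C → Reflects (frame ∈ᶜ C) (result (inClass C))
  inClass-reflects K  = ofʸ tt
  inClass-reflects T  = reflexive-reflects
  inClass-reflects S4 = subst (Reflects _) (sym (result->>= reflexiveᵐ _))
    (map-reflects {A = Reflexive R × Transitive R}
    (λ (r , t) → record
      { isEquivalence = ≡-isEquivalence
      ; reflexive     = λ { refl → r }
      ; trans         = λ {u} {v} {w} → t {u} {v} {w}
      })
    (λ p → (λ {u} → IsPreorder.refl p {u}) , (λ {u} {v} {w} → IsPreorder.trans p {u} {v} {w}))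
    (and-reflects {p = transitiveᵐ} reflexive-reflects transitive-reflects))
  inClass-reflects S5 = subst (Reflects _) (sym (result->>= reflexiveᵐ _))
    (map-reflects {A = Reflexive R × Partition (allFin size) ∅}
    (λ (r , p) → partition⇒equivalence r p)
    (λ e → (λ {u} → IsEquivalence.refl e {u}) , equivalence⇒partition (IsEquivalence.refl e) e)
    (and-reflects {p = step zeros (partitionᵐ (allFin size))} reflexive-reflects
      (partition-reflects (allFin size) ∅)))

  -- Only `S4` has a quadratic term, from the nested loops for transitivity. The 1 under `S5` is the
  -- initial `zeros`.
  classCost : Class → ℕ
  classCost K  = 0
  classCost T  = size * 2
  classCost S4 = size * 2 + size * (1 + size * 4)
  classCost S5 = size * 2 + (1 + size * 9)

  cost-inClass : ∀ C → cost (inClass C) ≤ classCost C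
  cost-inClass K  = z≤n
  cost-inClass T  = cost-reflexive
  cost-inClass S4 = cost->>=-≤ reflexiveᵐ cost-reflexive λ b → cost-if b cost-transitive z≤n
  cost-inClass S5 = cost->>=-≤ reflexiveᵐ cost-reflexive λ b → cost-if b
    (s≤s (subst (λ l → cost (partitionᵐ (allFin size) ∅) ≤ l * 9) length-worlds
      (cost-partition (allFin size) ∅)))
    z≤n

  valid-reflects : Reflects Valid (result checkCertificate)
  valid-reflects = subst (Reflects _) (sym (result->>= (inClass class) _))
    (and-reflects {p = checkRefuted} (inClass-reflects class) (refutes-reflects formula world))

  cost-check : cost checkCertificate ≤ classCost class + (∣ formula ∣ * nodeCost + 1)
  cost-check = cost->>=-≤ (inClass class) (cost-inClass class) λ b →
    cost-if b (cost-refutes formula world) z≤n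

  -- Absorbing the costs into the final bounds

  f n : ℕ
  f = ∣ formula ∣
  n = size

  -- The distinguished world excludes an empty frame; this is what lets additive constants be
  -- absorbed into multiples of `n`.
  1≤n : 1 ≤ n
  1≤n = 1≤Fin world

  1≤fn : 1 ≤ f * n
  1≤fn = *-mono-≤ (1≤∣ formula ∣) 1≤n

  n≤fn : n ≤ f * n
  n≤fn = ≤-trans (≤-reflexive (sym (+-identityʳ n))) (*-monoˡ-≤ n (1≤∣ formula ∣))

  refuted-bound : f * nodeCost + 1 ≤ 8 * (f * n)
  refuted-bound = begin
    -- The 2 grows to `2 * n` and the final 1 to `f * n`, which gives 2 + 5 + 1 = 8.
    f * (2 + n * 5) + 1         ≤⟨ +-mono-≤ (*-monoʳ-≤ f (+-monoˡ-≤ (n * 5) (*-monoʳ-≤ 2 1≤n))) 1≤fn ⟩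
    f * (2 * n + n * 5) + f * n ≡⟨ arith f n ⟩
    8 * (f * n)                 ∎
    where
    open ≤-Reasoning
    arith : ∀ f n → f * (2 * n + n * 5) + f * n ≡ 8 * (f * n)
    arith = solve-∀

  -- The factor 12 comes from `S5`: 2 for reflexivity, 9 for the partition loop and 1 for the
  -- absorbed constant.
  class-bound : ∀ C → C ≢ S4 → classCost C ≤ 12 * (f * n)
  class-bound K  _ = z≤n
  class-bound T  _ = begin
    n * 2        ≡⟨ *-comm n 2 ⟩
    2 * n        ≤⟨ *-mono-≤ {2} {12} (m≤m+n 2 10) n≤fn ⟩
    12 * (f * n) ∎
    where open ≤-Reasoning
  class-bound S4 C≢S4 = contradiction refl C≢S4
  class-bound S5 _ = begin
    n * 2 + (1 + n * 9) ≤⟨ +-monoʳ-≤ (n * 2) (+-monoˡ-≤ (n * 9) 1≤n) ⟩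
    n * 2 + (n + n * 9) ≡⟨ arith n ⟩
    12 * n              ≤⟨ *-monoʳ-≤ 12 n≤fn ⟩
    12 * (f * n)        ∎
    where
    open ≤-Reasoning
    arith : ∀ n → n * 2 + (n + n * 9) ≡ 12 * n
    arith = solve-∀

  -- The coefficient 4 is relaxed to 20 so that one constant serves both summands of the quadratic
  -- bound.
  S4-bound : classCost S4 ≤ 12 * (f * n) + 20 * (n * n)
  S4-bound = begin
    n * 2 + n * (1 + n * 4)      ≡⟨ arith n ⟩
    3 * n + 4 * (n * n)          ≤⟨ +-mono-≤ (*-mono-≤ {3} {12} (m≤m+n 3 9) n≤fn)
                                               (*-monoˡ-≤ (n * n) (m≤m+n 4 16)) ⟩
    12 * (f * n) + 20 * (n * n)  ∎
    where
    open ≤-Reasoning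
    arith : ∀ n → n * 2 + n * (1 + n * 4) ≡ 3 * n + 4 * (n * n)
    arith = solve-∀

  cost-refuted-linear : cost checkRefuted ≤ 20 * (f * n)
  cost-refuted-linear = ≤-trans (cost-refutes formula world)
    (≤-trans refuted-bound (*-monoˡ-≤ (f * n) (m≤m+n 8 12)))

  cost-check-linear : class ≢ S4 → cost checkCertificate ≤ 20 * (f * n)
  cost-check-linear C≢S4 = begin
    cost checkCertificate                    ≤⟨ cost-check ⟩
    classCost class + (f * nodeCost + 1)     ≤⟨ +-mono-≤ (class-bound class C≢S4) refuted-bound ⟩
    12 * (f * n) + 8 * (f * n)               ≡⟨ arith (f * n) ⟩
    20 * (f * n)                             ∎
    where
    open ≤-Reasoning
    arith : ∀ m → 12 * m + 8 * m ≡ 20 * m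
    arith = solve-∀

  classCost-quadratic : ∀ C → classCost C ≤ 12 * (f * n) + 20 * (n * n)
  classCost-quadratic K  = z≤n
  classCost-quadratic T  = ≤-trans (class-bound T λ ()) (m≤m+n _ _)
  classCost-quadratic S4 = S4-bound
  classCost-quadratic S5 = ≤-trans (class-bound S5 λ ()) (m≤m+n _ _)

  cost-check-quadratic : cost checkCertificate ≤ 20 * (f * n + n * n)
  cost-check-quadratic = begin
    cost checkCertificate                        ≤⟨ cost-check ⟩
    classCost class + (f * nodeCost + 1)         ≤⟨ +-mono-≤ (classCost-quadratic class) refuted-bound ⟩
    12 * (f * n) + 20 * (n * n) + 8 * (f * n)    ≡⟨ arith (f * n) (n * n) ⟩
    20 * (f * n + n * n)                         ∎
    where
    open ≤-Reasoning
    arith : ∀ m k → 12 * m + 20 * k + 8 * m ≡ 20 * (m + k)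
    arith = solve-∀

proposition2 : ((c : Certificate) → let open Certificate c in
    Valid → ¬ (formula ValidOn class))
    × (∃[ k ] ((c : Certificate) → let open Certificate c in let open Run c in
    Reflects Valid (result checkCertificate)
    × Reflects Refuted (result checkRefuted)
    × (cost checkRefuted ≤ k * (∣ formula ∣ * size))
    × (class ≢ S4 → cost checkCertificate ≤ k * (∣ formula ∣ * size))
    × (cost checkCertificate ≤ k * (∣ formula ∣ * size + size * size))))
proposition2 =
  -- The certificate's own model is the counterexample: validity on the class is instantiated at it.
  (λ c (F∈C , refuted) valid →
    let open Certificate c in refuted (valid frame F∈C valuation world)) ,
  -- 20 = 12 + 8, for class membership and for refutation.
  20 , λ c → let open Certificate c; open Correctness c in
    valid-reflects ,
    refutes-reflects formula world ,
    cost-refuted-linear ,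
    cost-check-linear ,
    cost-check-quadratic
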